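{- Let $D$ be a skew diagram, i.e. $D=\mathbb{S}(\alpha)$ for some weak composition $\alpha$. Then $\mathrm{MaxG}(D)=\mathrm{sf}(D)$.
   Context: A diagram is a finite set of cells at positions $(r,c)$ with $r,c$ positive integers ($r$ = row, counted from the bottom; $c$ = column), at most one cell per position; each cell is either an ordinary cell, written $(r,c)$, or a ghost cell, written $\langle r,c\rangle$. A position is empty if it contains no cell of either kind. K-Kohnert move at row $r$ of a diagram $D$: let the rightmost cell of row $r$ (ghost or not) lie in column $c$. The move does nothing if (i) that cell is a ghost cell, or (ii) every position $(r',c)$ with $r'<r$ is occupied, or (iii) letting $\hat r<r$ be maximal with $(\hat r,c)$ empty, some position $(r^*,c)$ with $\hat r<r^*<r$ holds a ghost cell. Otherwise there are two choices: the Kohnert move moves the cell from $(r,c)$ to $(\hat r,c)$; the ghost move moves the cell from $(r,c)$ to $(\hat r,c)$ and places a ghost cell $\langle r,c\rangle$ in position $(r,c)$. $KKD(D)$ is the set consisting of $D$ and all diagrams obtained from $D$ by finite sequences of K-Kohnert moves. $\mathrm{MaxG}(D)=\max\{|G(T)| : T\in KKD(D)\}$ where $G(T)$ is the set of ghost cells of $T$. Snow diagram: for a diagram $D$ with no ghost cells, process the rows from top to bottom; in each row, mark the rightmost cell of that row which has no already-marked cell above it in the same column (if such a cell exists). Marked cells are dark clouds. Then place a snowflake in every empty position lying strictly below some dark cloud in the same column. $\mathrm{sf}(D)$ is the number of snowflakes. Skew diagram: for a weak composition $\alpha=(\alpha_1,\dots,\alpha_n)$, $\mathbb{S}(\alpha)$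 is built as follows: left-justify $\alpha_i$ cells in row $i$ for each $i\in[n]$; then for $j$ from $1$ to $n$ with $\alpha_j>0$, take $i<j$ maximal with $\alpha_i>0$ (if it exists), and if $\alpha_i>\alpha_j$, shift all rows $k\ge j$ to the right by $\alpha_i-\alpha_j$ columns; finally shift each row $j\in[n]$ to the right by $|\{i : 1\le i<j,\ \alpha_i=0\}|$ columns. All cells are ordinary cells. -}

module Defs where

open import Data.Nat using (ℕ; zero; suc; _+_; _∸_; _<_; _≤_; _≡ᵇ_; _⊔_)
open import Data.Bool using (Bool; true; false; if_then_else_; _∧_)
open import Data.Maybe using (Maybe; just; nothing)
open import Data.Product using (_×_; _,_; ∃-syntax)
open import Data.List using (List; []; _∷_; length; upTo; downFrom; foldr; map)
open import Data.Nat.ListAction using (sum)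
open import Data.List.Membership.Propositional using (_∈_)
open import Data.List.Relation.Unary.Unique.Propositional using (Unique)
open import Function.Bundles using (_⇔_)
open import Relation.Binary.PropositionalEquality using (_≡_; _≢_)
open import Relation.Binary.Construct.Closure.ReflexiveTransitive using (Star)

-- Conventions: rows and columns are 0-indexed here (paper's row r ↦ r-1,
-- column c ↦ c-1); row 0 is the bottom row.

data Content : Set where
  empty ordinary ghost : Content

-- A diagram: content of every position (row, column).
Diagram : Set
Diagram = ℕ → ℕ → Content

isEmpty : Content → Bool
isEmpty empty = true
isEmpty _     = false

move : Diagram → (r c r̂ : ℕ) → Content → Diagram
move D r c r̂ k r' c' =
  if (r' ≡ᵇ r̂) ∧ (c' ≡ᵇ c) then ordinary
  else if (r' ≡ᵇ r) ∧ (c' ≡ᵇ c) then k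
  else D r' c'

record MoveData (D : Diagram) (r c r̂ : ℕ) : Set where
  field
    rightmost   : D r c ≢ empty
    rightmost'  : ∀ c' → c < c' → D r c' ≡ empty
    notGhost    : D r c ≡ ordinary
    below       : r̂ < r
    hatEmpty    : D r̂ c ≡ empty
    hatMaximal  : ∀ r' → r̂ < r' → r' < r → D r' c ≢ empty
    noGhostBetw : ∀ r' → r̂ < r' → r' < r → D r' c ≢ ghost

data KKStep (D : Diagram) : Diagram → Set where
  kohnert : ∀ {r c r̂} → MoveData D r c r̂ → KKStep D (move D r c r̂ empty)
  ghostMv : ∀ {r c r̂} → MoveData D r c r̂ → KKStep D (move D r c r̂ ghost)

KKD : Diagram → Diagram → Set
KKD D T = Star KKStep D T

NumGhosts : Diagram → ℕ → Set
NumGhosts T k = ∃[ l ] (Unique l × length l ≡ k ×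
                  (∀ r c → ((r , c) ∈ l) ⇔ (T r c ≡ ghost)))

IsMaxG : Diagram → ℕ → Set
IsMaxG D m = (∃[ T ] (KKD D T × NumGhosts T m)) ×
             (∀ T k → KKD D T → NumGhosts T k → k ≤ m)

-- Snow diagrams, for a ghost-free diagram whose cells all lie in rows < H
-- and columns < W.

-- dark clouds recorded as: column ↦ row of its (unique) dark cloud
Marks : Set
Marks = ℕ → Maybe ℕ

unmarked : Maybe ℕ → Bool
unmarked nothing  = true
unmarked (just _) = false

rightmostFree : Diagram → Marks → ℕ → ℕ → Maybe ℕ
rightmostFree D m r zero    = nothing
rightmostFree D m r (suc c) =
  if (Data.Bool.not (isEmpty (D r c))) ∧ unmarked (m c) then just c
  else rightmostFree D m r c

mark : Marks → ℕ → ℕ → Marks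
mark m r c c' = if c' ≡ᵇ c then just r else m c'

processRows : Diagram → ℕ → List ℕ → Marks → Marks
processRows D W []       m = m
processRows D W (r ∷ rs) m with rightmostFree D m r W
... | nothing = processRows D W rs m
... | just c  = processRows D W rs (mark m r c)

darkClouds : ℕ → ℕ → Diagram → Marks
darkClouds H W D = processRows D W (downFrom H) (λ _ → nothing)

count : (ℕ → Bool) → List ℕ → ℕ
count p = foldr (λ x n → if p x then suc n else n) 0

sf : ℕ → ℕ → Diagram → ℕ
sf H W D = sum (map snowInCol (upTo W))
  where
  snowInCol : ℕ → ℕ
  snowInCol c with darkClouds H W D c
  ... | nothing = 0
  ... | just r₀ = count (λ r → isEmpty (D r c)) (upTo r₀)

-- For each row: (total right shift, length).
-- prev = last nonzero part so far (0 if none), acc = accumulated shift from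
-- the second step, zs = number of zero parts so far.
skewRowsAux : (prev acc zs : ℕ) → List ℕ → List (ℕ × ℕ)
skewRowsAux prev acc zs []            = []
skewRowsAux prev acc zs (zero ∷ as)   = (0 , 0) ∷ skewRowsAux prev acc (suc zs) as
skewRowsAux prev acc zs (suc a ∷ as)  =
  (acc + (prev ∸ suc a) + zs , suc a) ∷ skewRowsAux (suc a) (acc + (prev ∸ suc a)) zs as

skewRows : List ℕ → List (ℕ × ℕ)
skewRows = skewRowsAux 0 0 0

lookupRow : List (ℕ × ℕ) → ℕ → ℕ × ℕ
lookupRow []       _       = (0 , 0)
lookupRow (x ∷ xs) zero    = x
lookupRow (x ∷ xs) (suc i) = lookupRow xs i

inRange : ℕ → ℕ → ℕ → Bool
inRange s len c = (s Data.Nat.≤ᵇ c) ∧ (c Data.Nat.<ᵇ (s + len))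

skewCell : (ℕ × ℕ) → ℕ → Content
skewCell (s , len) c = if inRange s len c then ordinary else empty

skew : List ℕ → Diagram
skew α r c = skewCell (lookupRow (skewRows α) r) c

skewHeight : List ℕ → ℕ
skewHeight = length

skewWidth : List ℕ → ℕ
skewWidth α = foldr (λ { (s , len) w → (s + len) ⊔ w }) 0 (skewRows α)

module Submission where

-- Upper bound. If the cells of a column keep their vertical order, every move lowers a
-- contiguous block of them by one row. Let A(i,c) consist of the current row of the cell
-- (i,c) of D and of the rows of the ghosts that it left behind. For a skew diagram, the
-- A(i,c) increase strictly up each column and decrease weakly along each row, as in a
-- set-valued tableau. The cells of D are covered by the hooks of the dark clouds (the
-- cells left of the cloud and those below it), and along one hook the A(i,c) descend, so
-- that they leave room for at most one ghost per snowflake of the cloud's column.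
--
-- Lower bound. Dark clouds lie further right the higher they are. Take them from left to
-- right; for the cloud (i,m), first pack the cells in rows ≤ i of all columns > m at the
-- bottom by Kohnert moves. These columns have at most as many cells in rows ≤ i as
-- column m, hence do not obstruct ghost moves in column m at rows i, i - 1, … until the
-- cells below are packed, and this creates one ghost per snowflake of column m.

open import Defs
open import Data.Bool using (Bool; true; false; if_then_else_; not)
open import Data.Bool.Properties using (T-≡)
open import Data.Empty using (⊥-elim)
open import Data.List using (List; []; _∷_; _++_; _∷ʳ_; foldr; length; upTo; downFrom; map; concatMap)
open import Data.List.Properties using (length-++; length-map; length-upTo; upTo-∷ʳ; map-++; map-cong)
open import Data.List.Membership.Propositional using (_∈_; lose)
open import Data.List.Membership.Propositional.Properties
  using (∈-∃++; ∈-++⁻; ∈-++⁺ˡ; ∈-++⁺ʳ; ∈-map⁺; ∈-concatMap⁺; ∈-upTo⁺)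
open import Data.List.Relation.Unary.All as All using ()
open import Data.List.Relation.Unary.AllPairs using ([]; _∷_)
open import Data.List.Relation.Unary.Any using (here; there)
open import Data.List.Relation.Unary.Unique.Propositional using (Unique)
open import Data.Maybe using (just; nothing; maybe′)
open import Data.Maybe.Properties using (just-injective)
open import Data.Nat
open import Data.Nat.ListAction using (sum)
open import Data.Nat.ListAction.Properties using (sum-++)
open import Data.Nat.Properties
open import Algebra.Properties.CommutativeSemigroup +-commutativeSemigroup using (xy∙z≈xz∙y)
open import Data.Product using (Σ; ∃-syntax; _×_; _,_; proj₁; proj₂)
open import Data.Sum using (_⊎_; inj₁; inj₂)
open import Function using (_∘_; case_of_)
open import Function.Bundles using (mk⇔; Equivalence)
open import Relation.Binary.Construct.Closure.ReflexiveTransitive using (ε; _◅_; _◅◅_)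
open import Relation.Binary.Definitions using (tri<; tri≈; tri>)
open import Relation.Binary.PropositionalEquality
open import Relation.Nullary using (¬_; yes; no; contradiction)

-- Pigeonhole principle and counting below a bound

-- Induct on `xs`, deleting from `zs` the partner of the head; injectivity of `R` keeps the partners
-- of all other entries. With a relation in place of a function, the partner may be chosen by mere
-- existence.
injective-length : ∀ {A B : Set} (R : A → B → Set) →
  (∀ {x y z} → R x z → R y z → x ≡ y) →
  ∀ {xs zs} → Unique xs → (∀ {x} → x ∈ xs → ∃[ z ] z ∈ zs × R x z) →
  length xs ≤ length zs
injective-length R inj {[]} u f = z≤n
injective-length R inj {x ∷ xs} (x∉xs ∷ u) f with f (here refl)
... | z , z∈zs , xRz with ∈-∃++ z∈zs
... | ys , ws , refl = begin
  suc (length xs)              ≤⟨ s≤s (injective-length R inj u f′) ⟩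
  suc (length (ys ++ ws))      ≡⟨ cong suc (length-++ ys) ⟩
  suc (length ys + length ws)  ≡⟨ +-suc (length ys) (length ws) ⟨
  length ys + suc (length ws)  ≡⟨ length-++ ys ⟨
  length (ys ++ z ∷ ws)        ∎
  where
  open ≤-Reasoning
  f′ : ∀ {y} → y ∈ xs → ∃[ z′ ] z′ ∈ ys ++ ws × R y z′
  f′ y∈xs with f (there y∈xs)
  ... | z′ , z′∈ , yRz′ with ∈-++⁻ ys z′∈
  ... | inj₁ p         = z′ , ∈-++⁺ˡ p , yRz′
  ... | inj₂ (here refl) = contradiction (inj xRz yRz′) (All.lookup x∉xs y∈xs)
  ... | inj₂ (there p) = z′ , ∈-++⁺ʳ ys p , yRz′

-- A form of `count p (upTo n)` that recurses on the bound, so that passing from `n` to `suc n`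
-- tests only `p n`; `count-upTo` links the two.
cnt : (ℕ → Bool) → ℕ → ℕ
cnt p zero    = 0
cnt p (suc n) = if p n then suc (cnt p n) else cnt p n

cnt-cong : ∀ {p q} n → (∀ {r} → r < n → p r ≡ q r) → cnt p n ≡ cnt q n
cnt-cong zero    p≗q = refl
cnt-cong {p} {q} (suc n) p≗q
  rewrite p≗q (n<1+n n) | cnt-cong {p} {q} n (p≗q ∘ m<n⇒m<1+n) = refl

cnt-suc-≤ : ∀ p n → cnt p n ≤ cnt p (suc n)
cnt-suc-≤ p n with p n
... | true  = n≤1+n _
... | false = ≤-refl

cnt-monoʳ : ∀ p {m n} → m ≤ n → cnt p m ≤ cnt p n
cnt-monoʳ p m≤n = go (≤⇒≤′ m≤n)
  where
  go : ∀ {m n} → m ≤′ n → cnt p m ≤ cnt p n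
  go ≤′-refl       = ≤-refl
  go (≤′-step m≤n) = ≤-trans (go m≤n) (cnt-suc-≤ p _)

cnt-monoˡ : ∀ {p q} n → (∀ {r} → r < n → p r ≡ true → q r ≡ true) → cnt p n ≤ cnt q n
cnt-monoˡ zero p⇒q = z≤n
cnt-monoˡ {p} {q} (suc n) p⇒q with p n in pn
... | false = ≤-trans (cnt-monoˡ n (p⇒q ∘ m<n⇒m<1+n)) (cnt-suc-≤ q n)
... | true rewrite p⇒q (n<1+n n) pn = s≤s (cnt-monoˡ n (p⇒q ∘ m<n⇒m<1+n))

cnt-not : ∀ p n → cnt p n + cnt (not ∘ p) n ≡ n
cnt-not p zero    = refl
cnt-not p (suc n) with p n
... | true  = cong suc (cnt-not p n)
... | false = trans (+-suc (cnt p n) _) (cong suc (cnt-not p n))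

cnt-≡0 : ∀ p {r n} → cnt p n ≡ 0 → r < n → p r ≡ false
cnt-≡0 p {r} {n} cnt≡0 r<n with p r in pr
... | false = refl
... | true  = contradiction (cnt-monoʳ p r<n) (<⇒≱ (begin-strict
  cnt p n       ≡⟨ cnt≡0 ⟩
  0             <⟨ z<s ⟩
  suc (cnt p r) ≡⟨ cong (λ b → if b then suc (cnt p r) else cnt p r) pr ⟨
  cnt p (suc r) ∎))
  where open ≤-Reasoning

cnt-insert : ∀ {p q n m} → m < n → p m ≡ false → q m ≡ true →
  (∀ {r} → r ≢ m → r < n → q r ≡ p r) → cnt q n ≡ suc (cnt p n)
cnt-insert {p} {q} {suc n} {m} m<1+n pm qm q≗p with m<1+n⇒m<n∨m≡n m<1+n
... | inj₂ refl rewrite pm | qm =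
  cong suc (cnt-cong n (λ r<n → q≗p (<⇒≢ r<n) (m<n⇒m<1+n r<n)))
... | inj₁ m<n rewrite q≗p (≢-sym (<⇒≢ m<n)) (n<1+n n)
                 | cnt-insert {p} {q} m<n pm qm (λ r≢m r<n → q≗p r≢m (m<n⇒m<1+n r<n)) with p n
... | true  = refl
... | false = refl

-- Supplies the landing row of a move: the search runs downwards, so the gap found is the highest
-- one.
cnt-gap : ∀ p n → cnt p n < n →
  ∃[ m ] m < n × p m ≡ false × (∀ {r} → m < r → r < n → p r ≡ true)
cnt-gap p (suc n) cnt<n with p n in pn
... | false = n , n<1+n n , pn , λ n<r r<1+n → contradiction r<1+n (≤⇒≯ n<r)
... | true with cnt-gap p n (s<s⁻¹ cnt<n)
... | m , m<n , pm , full = m , m<n⇒m<1+n m<n , pm , full′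
  where
  full′ : ∀ {r} → m < r → r < suc n → p r ≡ true
  full′ m<r r<1+n with m<1+n⇒m<n∨m≡n r<1+n
  ... | inj₁ r<n  = full m<r r<n
  ... | inj₂ refl = pn

-- f packs the p-indices between a and n into the values r, …, x - 1.
cnt-embed : ∀ p (f : ℕ → ℕ) → (∀ {i j} → i < j → p i ≡ true → p j ≡ true → f i < f j) →
  ∀ {a n r x} → a ≤ n → r ≤ x → (∀ {j} → a ≤ j → j < n → p j ≡ true → r ≤ f j × f j < x) →
  r + cnt p n ≤ x + cnt p a
cnt-embed p f f-mono {a} {n} a≤n = go (≤⇒≤′ a≤n)
  where
  go : ∀ {n r x} → a ≤′ n → r ≤ x → (∀ {j} → a ≤ j → j < n → p j ≡ true → r ≤ f j × f j < x) →
    r + cnt p n ≤ x + cnt p a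
  go ≤′-refl r≤x range = +-monoˡ-≤ (cnt p a) r≤x
  go {suc n} {r} {x} (≤′-step a≤n) r≤x range with p n in pn
  ... | false = go a≤n r≤x (λ a≤j j<n → range a≤j (m<n⇒m<1+n j<n))
  ... | true with range (≤′⇒≤ a≤n) (n<1+n n) pn
  ... | r≤fn , fn<x = begin
    r + suc (cnt p n)     ≡⟨ +-suc r _ ⟩
    suc (r + cnt p n)     ≤⟨ s≤s (go a≤n r≤fn λ a≤j j<n pj →
                               proj₁ (range a≤j (m<n⇒m<1+n j<n) pj) , f-mono j<n pj pn) ⟩
    suc (f n + cnt p a)   ≤⟨ +-monoˡ-≤ (cnt p a) fn<x ⟩
    x + cnt p a           ∎
    where open ≤-Reasoning

count-++ : ∀ p xs ys → count p (xs ++ ys) ≡ count p xs + count p ys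
count-++ p []       ys = refl
count-++ p (x ∷ xs) ys with p x
... | true  = cong suc (count-++ p xs ys)
... | false = count-++ p xs ys

count-upTo : ∀ p n → count p (upTo n) ≡ cnt p n
count-upTo p zero    = refl
count-upTo p (suc n) = begin
  count p (upTo (suc n))              ≡⟨ cong (count p) (upTo-∷ʳ n) ⟨
  count p (upTo n ∷ʳ n)               ≡⟨ count-++ p (upTo n) _ ⟩
  count p (upTo n) + count p (n ∷ []) ≡⟨ cong (_+ count p (n ∷ [])) (count-upTo p n) ⟩
  cnt p n + count p (n ∷ [])          ≡⟨ last ⟩
  cnt p (suc n)                       ∎
  where
  open ≡-Reasoning
  last : cnt p n + count p (n ∷ []) ≡ cnt p (suc n)
  last with p n
  ... | true  = +-comm (cnt p n) 1
  ... | false = +-identityʳ (cnt p n)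

-- The effect of one move on a diagram

data MoveView (T : Diagram) (r c r̂ : ℕ) (k : Content) (r′ c′ : ℕ) : Content → Set where
  target : r′ ≡ r̂ → c′ ≡ c → MoveView T r c r̂ k r′ c′ ordinary
  source : r′ ≡ r → c′ ≡ c → MoveView T r c r̂ k r′ c′ k
  other  : (c′ ≡ c → r′ ≢ r̂ × r′ ≢ r) → MoveView T r c r̂ k r′ c′ (T r′ c′)

≡ᵇ-refl : ∀ n → (n ≡ᵇ n) ≡ true
≡ᵇ-refl n = Equivalence.to T-≡ (≡⇒≡ᵇ n n refl)

≢⇒≡ᵇ : ∀ {m n} → m ≢ n → (m ≡ᵇ n) ≡ false
≢⇒≡ᵇ {m} {n} m≢n with m ≡ᵇ n in eq
... | false = refl
... | true  = contradiction (≡ᵇ⇒≡ m n (Equivalence.from T-≡ eq)) m≢n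

moveView : ∀ T r c r̂ k r′ c′ → MoveView T r c r̂ k r′ c′ (move T r c r̂ k r′ c′)
moveView T r c r̂ k r′ c′ with c′ ≟ c | r′ ≟ r̂ | r′ ≟ r
... | yes refl | yes refl | _        rewrite ≡ᵇ-refl r′ | ≡ᵇ-refl c′ = target refl refl
... | yes refl | no r′≢r̂ | yes refl rewrite ≢⇒≡ᵇ r′≢r̂ | ≡ᵇ-refl r′ | ≡ᵇ-refl c′ = source refl refl
... | yes refl | no r′≢r̂ | no r′≢r  rewrite ≢⇒≡ᵇ r′≢r̂ | ≢⇒≡ᵇ r′≢r = other λ _ → r′≢r̂ , r′≢r
... | no c′≢c  | _        | _ rewrite ≢⇒≡ᵇ c′≢c with r′ ≡ᵇ r̂ | r′ ≡ᵇ r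
...   | true  | true  = other λ eq → contradiction eq c′≢c
...   | true  | false = other λ eq → contradiction eq c′≢c
...   | false | true  = other λ eq → contradiction eq c′≢c
...   | false | false = other λ eq → contradiction eq c′≢c

move-target : ∀ T r c r̂ k → move T r c r̂ k r̂ c ≡ ordinary
move-target T r c r̂ k rewrite ≡ᵇ-refl r̂ | ≡ᵇ-refl c = refl

move-source : ∀ T {r c r̂} k → r̂ < r → move T r c r̂ k r c ≡ k
move-source T {r} {c} {r̂} k r̂<r
  rewrite ≢⇒≡ᵇ (≢-sym (<⇒≢ r̂<r)) | ≡ᵇ-refl r | ≡ᵇ-refl c = refl

move-other : ∀ T {r c r̂} k {r′ c′} → (c′ ≡ c → r′ ≢ r̂ × r′ ≢ r) →
  move T r c r̂ k r′ c′ ≡ T r′ c′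
move-other T {r} {c} {r̂} k {r′} {c′} away
  with move T r c r̂ k r′ c′ | moveView T r c r̂ k r′ c′
... | _ | target r′≡r̂ c′≡c = contradiction r′≡r̂ (proj₁ (away c′≡c))
... | _ | source r′≡r c′≡c = contradiction r′≡r (proj₂ (away c′≡c))
... | _ | other _          = refl

isOrdinary : ∀ {x} → x ≢ empty → x ≢ ghost → x ≡ ordinary
isOrdinary {empty}    ≢e ≢g = contradiction refl ≢e
isOrdinary {ordinary} ≢e ≢g = refl
isOrdinary {ghost}    ≢e ≢g = contradiction refl ≢g

-- Staircase shapes

occupied : Diagram → ℕ → ℕ → Bool
occupied T c r = not (isEmpty (T r c))

vacant : Diagram → ℕ → ℕ → Bool
vacant T c r = isEmpty (T r c)

-- The properties of skew diagrams on which both bounds rest. Together, `rightEnds` and `leftEnds`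
-- say that the nonempty rows are intervals whose two ends move weakly to the right going up.
record Staircase (D : Diagram) (H W : ℕ) : Set where
  field
    noGhost   : ∀ r c → D r c ≢ ghost
    rowBound  : ∀ {r c} → D r c ≡ ordinary → r < H
    colBound  : ∀ {r c} → D r c ≡ ordinary → c < W
    rightEnds : ∀ {j i m c} → j < i → D i m ≡ ordinary → D j c ≡ ordinary → m < c →
                D i c ≡ ordinary
    leftEnds  : ∀ {j i m b c} → j ≤ i → D i m ≡ ordinary → D j c ≡ ordinary →
                m ≤ b → b ≤ c → D j b ≡ ordinary

  occupied⇒cell : ∀ {r c} → occupied D c r ≡ true → D r c ≡ ordinary
  occupied⇒cell {r} {c} occ with D r c in eq
  ... | ordinary = refl
  ... | ghost    = contradiction eq (noGhost r c)

cell⇒occupied : ∀ {T r c} → T r c ≡ ordinary → occupied T c r ≡ true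
cell⇒occupied eq rewrite eq = refl

-- Labelling the cells by their current rows

opaque
  -- A move carries one cell over the block below it; to preserve the vertical order, every label in
  -- rows `r̂ + 1` to `r` of column `c` drops by one instead. Kept opaque, so that `lowerView` is
  -- the only access.
  lower : (ℕ → ℕ → ℕ) → (r c r̂ : ℕ) → ℕ → ℕ → ℕ
  lower h r c r̂ i c′ with c′ ≟ c | r̂ <? h i c′ | h i c′ ≤? r
  ... | yes _ | yes _ | yes _ = pred (h i c′)
  ... | _     | _     | _     = h i c′

data LowerView (h : ℕ → ℕ → ℕ) (r c r̂ i c′ : ℕ) : ℕ → Set where
  dropped : ∀ {y} → c′ ≡ c → h i c′ ≡ suc y → r̂ ≤ y → y < r → LowerView h r c r̂ i c′ y
  kept    : (c′ ≡ c → r̂ < h i c′ → r < h i c′) → LowerView h r c r̂ i c′ (h i c′)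

opaque
  unfolding lower

  lowerView : ∀ h r c r̂ i c′ → LowerView h r c r̂ i c′ (lower h r c r̂ i c′)
  lowerView h r c r̂ i c′ with c′ ≟ c | r̂ <? h i c′ | h i c′ ≤? r
  ... | yes eq | no ¬lt | _      = kept λ _ lt → contradiction lt ¬lt
  ... | yes eq | yes lt | no ¬le = kept λ _ _ → ≰⇒> ¬le
  ... | no neq | _      | _      = kept λ eq → contradiction eq neq
  ... | yes eq | yes lt | yes le with h i c′ in heq
  ...   | suc y = dropped eq heq (s≤s⁻¹ lt) le

lower-drop : ∀ h {r c r̂ i y} → h i c ≡ suc y → r̂ ≤ y → y < r → lower h r c r̂ i c ≡ y
lower-drop h {r} {c} {r̂} {i} heq r̂≤y y<r with lower h r c r̂ i c | lowerView h r c r̂ i c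
... | _ | dropped _ heq′ _ _ = suc-injective (trans (sym heq′) heq)
... | _ | kept stay = contradiction (stay refl (subst (r̂ <_) (sym heq) (s≤s r̂≤y)))
                        (≤⇒≯ (subst (_≤ r) (sym heq) y<r))

lower-keep : ∀ h {r c r̂ i c′} → (c′ ≡ c → r̂ < h i c′ → r < h i c′) → lower h r c r̂ i c′ ≡ h i c′
lower-keep h {r} {c} {r̂} {i} {c′} stay with lower h r c r̂ i c′ | lowerView h r c r̂ i c′
... | _ | kept _ = refl
... | _ | dropped eq heq r̂≤y y<r = contradiction
  (stay eq (subst (r̂ <_) (sym heq) (s≤s r̂≤y))) (≤⇒≯ (subst (_≤ r) (sym heq) y<r))

lower-≤ : ∀ h r c r̂ i c′ → lower h r c r̂ i c′ ≤ h i c′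
lower-≤ h r c r̂ i c′ with lower h r c r̂ i c′ | lowerView h r c r̂ i c′
... | y | dropped _ heq _ _ = subst (y ≤_) (sym heq) (n≤1+n y)
... | _ | kept _ = ≤-refl

-- The ghost ⟨r, c⟩ belongs to the cell (i, c) of D whose descent passed row r last.
record Owns (D : Diagram) (h : ℕ → ℕ → ℕ) (i r c : ℕ) : Set where
  field
    cell    : D i c ≡ ordinary
    passed  : h i c < r
    started : r ≤ i
    above   : ∀ {i′} → i < i′ → D i′ c ≡ ordinary → r < h i′ c
    left    : ∀ {b} → b < c → D i b ≡ ordinary → r ≤ h i b

-- h i c is the current row of the cell (i, c) of D, where the cells of a column keep
-- their vertical order: a move lowers a contiguous block of cells by one row each.
record Labelled (D T : Diagram) (h : ℕ → ℕ → ℕ) : Set where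
  field
    present : ∀ {i c} → D i c ≡ ordinary → T (h i c) c ≡ ordinary
    label  : ∀ {r c} → T r c ≡ ordinary → ∃[ i ] D i c ≡ ordinary × h i c ≡ r
    low    : ∀ i c → h i c ≤ i
    column : ∀ {i j c} → i < j → D i c ≡ ordinary → D j c ≡ ordinary → h i c < h j c
    row    : ∀ {i b c} → b < c → D i b ≡ ordinary → D i c ≡ ordinary → h i c ≤ h i b
    owner  : ∀ {r c} → T r c ≡ ghost → ∃[ i ] Owns D h i r c

-- Moves preserve labellings

module Upper {D : Diagram} {H W : ℕ} (S : Staircase D H W) where
  open Staircase S

  -- The content `k` left at the source is `empty` or `ghost`, so Kohnert moves and ghost moves are
  -- treated at once.
  module Step {T : Diagram} {h : ℕ → ℕ → ℕ} {r c r̂ : ℕ} {k : Content}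
              (M : MoveData T r c r̂) (L : Labelled D T h) (k≢ : k ≢ ordinary) where
    open MoveData M
    open Labelled L

    T′ : Diagram
    T′ = move T r c r̂ k

    h′ : ℕ → ℕ → ℕ
    h′ = lower h r c r̂

    -- Maximality of `r̂` excludes holes and the rule on intermediate ghosts excludes ghosts, so the
    -- rows that shift down form a solid block of cells.
    block : ∀ {y} → r̂ < y → y ≤ r → T y c ≡ ordinary
    block {y} r̂<y y≤r with m≤n⇒m<n∨m≡n y≤r
    ... | inj₁ y<r  = isOrdinary (hatMaximal y r̂<y y<r) (noGhostBetw y r̂<y y<r)
    ... | inj₂ refl = notGhost

    -- Climbing the block: an obstacle right of its cell in row y forces one in row y + 1,
    -- and finally one right of the moving cell.
    unobstructed : ∀ d {y b i} → y + d ≡ r → r̂ < y → c < b → D i c ≡ ordinary → D i b ≡ ordinary →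
      h i c ≡ y → T y b ≢ empty → ¬ (∀ {j} → i < j → D j b ≡ ordinary → y < h j b)
    unobstructed zero {y} {b} y+0≡r r̂<y c<b Dic Dib hi≡y T≢ barrier
      rewrite trans (sym (+-identityʳ y)) y+0≡r = T≢ (rightmost' b c<b)
    unobstructed (suc d) {y} {b} {i} y+1+d≡r r̂<y c<b Dic Dib hi≡y T≢ barrier
      with label (block {suc y} (m<n⇒m<1+n r̂<y)
                   (subst (suc y ≤_) (trans (sym (+-suc y d)) y+1+d≡r) (m≤m+n (suc y) d)))
    ... | j , Djc , hj≡1+y =
      unobstructed d (trans (sym (+-suc y d)) y+1+d≡r) (m<n⇒m<1+n r̂<y) c<b Djc Djb hj≡1+y
        (λ eq → contradiction (trans (sym (subst (λ x → T x b ≡ ordinary) hjb (present Djb))) eq) λ ())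
        (λ {j′} j<j′ Dj′b → subst (_< h j′ b) hjb (column j<j′ Djb Dj′b))
      where
      i<j : i < j
      i<j with <-cmp i j
      ... | tri< i<j _ _ = i<j
      ... | tri≈ _ refl _ = contradiction (trans (sym hi≡y) hj≡1+y) (<⇒≢ (n<1+n y))
      ... | tri> _ _ j<i = contradiction (subst₂ _<_ hj≡1+y hi≡y (column j<i Djc Dic))
                             (≤⇒≯ (n≤1+n y))
      Djb : D j b ≡ ordinary
      Djb = rightEnds i<j Djc Dib c<b
      -- Monotonicity along row `j` bounds the label above and the barrier bounds it below, so the
      -- obstacle recurs one row higher.
      hjb : h j b ≡ suc y
      hjb = ≤-antisym (subst (h j b ≤_) hj≡1+y (row c<b Djc Djb)) (barrier i<j Djb)

    present-≢ : ∀ {i r′ b} → D i b ≡ ordinary → T r′ b ≡ empty → h i b ≢ r′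
    present-≢ {b = b} Dib Te eq = contradiction
      (trans (sym (subst (λ x → T x b ≡ ordinary) eq (present Dib))) Te) λ ()

    present′ : ∀ {i b} → D i b ≡ ordinary → T′ (h′ i b) b ≡ ordinary
    present′ {i} {b} Dib with h′ i b | lowerView h r c r̂ i b
    ... | y | dropped refl heq r̂≤y y<r with m≤n⇒m<n∨m≡n r̂≤y
    ...   | inj₂ refl = move-target T r c r̂ k
    ...   | inj₁ r̂<y = trans (move-other T k λ _ → ≢-sym (<⇒≢ r̂<y) , <⇒≢ y<r) (block r̂<y (<⇒≤ y<r))
    present′ {i} {b} Dib | _ | kept stay =
      trans (move-other T k λ { refl → present-≢ Dib hatEmpty , λ eq → <-irrefl (sym eq)
        (stay refl (subst (r̂ <_) (sym eq) below)) }) (present Dib)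

    label′ : ∀ {r′ b} → T′ r′ b ≡ ordinary → ∃[ i ] D i b ≡ ordinary × h′ i b ≡ r′
    label′ {r′} {b} T′o with T′ r′ b | moveView T r c r̂ k r′ b
    ... | _ | source _ _ = contradiction T′o k≢
    ... | _ | target refl refl with label (block (n<1+n r̂) below)
    ...   | i , Dic , heq = i , Dic , lower-drop h heq ≤-refl below
    label′ {r′} {b} T′o | _ | other away with b ≟ c
    ... | no b≢c with label T′o
    ...   | i , Dib , heq = i , Dib , trans (lower-keep h λ b≡c → contradiction b≡c b≢c) heq
    label′ {r′} {b} T′o | _ | other away | yes refl with r̂ <? r′ | r′ <? r
    -- The block has shifted, so row `r′` now holds the cell that was labelled `suc r′`.
    ... | yes r̂<r′ | yes r′<r with label (block {suc r′} (m<n⇒m<1+n r̂<r′) r′<r)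
    ...   | i , Dic , heq = i , Dic , lower-drop h heq (<⇒≤ r̂<r′) r′<r
    label′ {r′} {b} T′o | _ | other away | yes refl | no r̂≮r′ | _ with label T′o
    ...   | i , Dic , refl = i , Dic , lower-keep h λ _ r̂<r′ → contradiction r̂<r′ r̂≮r′
    label′ {r′} {b} T′o | _ | other away | yes refl | yes _ | no r′≮r with label T′o
    ...   | i , Dic , refl = i , Dic ,
            lower-keep h λ _ _ → ≤∧≢⇒< (≮⇒≥ r′≮r) (≢-sym (proj₂ (away refl)))

    column′ : ∀ {i j b} → i < j → D i b ≡ ordinary → D j b ≡ ordinary → h′ i b < h′ j b
    column′ {i} {j} {b} i<j Dib Djb with h′ j b | lowerView h r c r̂ j b
    ... | _ | kept _ = ≤-<-trans (lower-≤ h r c r̂ i b) (column i<j Dib Djb)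
    ... | y | dropped refl hj r̂≤y y<r with h′ i b | lowerView h r c r̂ i b
    ...   | _ | dropped _ hi _ _ = s<s⁻¹ (subst₂ _<_ hi hj (column i<j Dib Djb))
    ...   | _ | kept stay with r̂ <? h i b
    ...     | yes r̂<hi = contradiction (<-trans (stay refl r̂<hi) (column i<j Dib Djb))
                           (≤⇒≯ (subst (_≤ r) (sym hj) y<r))
    -- Row `r̂` was empty, so a cell not above it lies strictly below it.
    ...     | no r̂≮hi = <-≤-trans (≤∧≢⇒< (≮⇒≥ r̂≮hi) (present-≢ Dib hatEmpty)) r̂≤y

    row′ : ∀ {i b b′} → b < b′ → D i b ≡ ordinary → D i b′ ≡ ordinary → h′ i b′ ≤ h′ i b
    row′ {i} {b} {b′} b<b′ Dib Dib′ with h′ i b | lowerView h r c r̂ i b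
    ... | _ | kept _ = ≤-trans (lower-≤ h r c r̂ i b′) (row b<b′ Dib Dib′)
    ... | y | dropped refl heq r̂≤y y<r with m≤n⇒m<n∨m≡n (subst (h i b′ ≤_) heq (row b<b′ Dib Dib′))
    ...   | inj₁ hib′≤y = ≤-trans (lower-≤ h r c r̂ i b′) (s≤s⁻¹ hib′≤y)
    -- The order along row `i` fails only if `(i, b)` drops out of row `suc y` while `(i, b′)` stays
    -- there; then `(i, b′)` is an obstacle to the right of the block.
    ...   | inj₂ hib′≡1+y = ⊥-elim (unobstructed (r ∸ suc y) (m+[n∸m]≡n y<r) (s≤s r̂≤y) b<b′ Dib Dib′ heq
            (λ eq → present-≢ Dib′ eq hib′≡1+y)
            (λ {j} i<j Djb′ → subst (_< h j b′) hib′≡1+y (column i<j Dib′ Djb′)))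

    -- Labels only fall, so `passed` survives. `above` could fail only with the ghost inside the
    -- block or in the landing row, and `left` only with the ghost itself as an obstacle to the
    -- right of the block.
    owns′ : ∀ {i r′ b} → T r′ b ≡ ghost → Owns D h i r′ b → Owns D h′ i r′ b
    owns′ {i} {r′} {b} T≡g O = record
      { cell = cell ; started = started
      ; passed = ≤-<-trans (lower-≤ h r c r̂ i b) passed
      ; above = above′ ; left = left′ }
      where
      open Owns O
      above′ : ∀ {i′} → i < i′ → D i′ b ≡ ordinary → r′ < h′ i′ b
      above′ {i′} i<i′ Di′b with h′ i′ b | lowerView h r c r̂ i′ b
      ... | _ | kept _ = above i<i′ Di′b
      ... | y | dropped refl heq r̂≤y y<r = ≤∧≢⇒< r′≤y r′≢y
        where
        r′≤y : r′ ≤ y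
        r′≤y = s≤s⁻¹ (subst (r′ <_) heq (above i<i′ Di′b))
        r′≢y : r′ ≢ y
        r′≢y refl with m≤n⇒m<n∨m≡n r̂≤y
        ... | inj₁ r̂<y = noGhostBetw y r̂<y y<r T≡g
        ... | inj₂ refl = contradiction (trans (sym T≡g) hatEmpty) λ ()
      left′ : ∀ {a} → a < b → D i a ≡ ordinary → r′ ≤ h′ i a
      left′ {a} a<b Dia with h′ i a | lowerView h r c r̂ i a
      ... | _ | kept _ = left a<b Dia
      ... | y | dropped refl heq r̂≤y y<r with m≤n⇒m<n∨m≡n (subst (r′ ≤_) heq (left a<b Dia))
      ...   | inj₁ r′<1+y = s≤s⁻¹ r′<1+y
      ...   | inj₂ refl = ⊥-elim (unobstructed (r ∸ suc y) (m+[n∸m]≡n y<r) (s≤s r̂≤y) a<b Dia cell heq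
              (λ eq → contradiction (trans (sym T≡g) eq) λ ()) above)

    owner′ : ∀ {r′ b} → T′ r′ b ≡ ghost → ∃[ i ] Owns D h′ i r′ b
    owner′ {r′} {b} T′≡g with T′ r′ b | moveView T r c r̂ k r′ b
    ... | _ | target _ _ = contradiction T′≡g λ ()
    ... | _ | other _ with owner T′≡g
    ...   | i , O = i , owns′ T′≡g O
    -- A new ghost belongs to the top cell of the block, the one labelled `r` before the move.
    owner′ {r′} {b} T′≡g | _ | source refl refl with label notGhost
    ...   | i , Dic , refl = i , record
            { cell = Dic ; passed = passed ; started = low i c
            ; above = λ i<i′ Di′c → subst (h i c <_)
                (sym (lower-keep h λ _ _ → column i<i′ Dic Di′c)) (column i<i′ Dic Di′c)
            ; left = λ a<c Dia → subst (h i c ≤_)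
                (sym (lower-keep h λ a≡c → contradiction a≡c (<⇒≢ a<c))) (row a<c Dia Dic) }
      where
      passed : h′ i c < h i c
      passed with h i c in heq | below
      ... | suc y | s≤s r̂≤y = s≤s (≤-reflexive (lower-drop h heq r̂≤y (n<1+n y)))

    labelled′ : Labelled D T′ h′
    labelled′ = record
      { present = present′ ; label = label′
      ; low = λ i b → ≤-trans (lower-≤ h r c r̂ i b) (low i b)
      ; column = column′ ; row = row′ ; owner = owner′ }

  labelled : ∀ {T T′ h} → KKD T T′ → Labelled D T h → ∃[ h′ ] Labelled D T′ h′
  labelled ε L = _ , L
  labelled (kohnert M ◅ s) L = labelled s (Step.labelled′ M L λ ())
  labelled (ghostMv M ◅ s) L = labelled s (Step.labelled′ M L λ ())

  initially : Labelled D D (λ i c → i)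
  initially = record
    { present = λ Dic → Dic ; label = λ {r} Drc → r , Drc , refl ; low = λ i c → ≤-refl
    ; column = λ i<j _ _ → i<j ; row = λ _ _ _ → ≤-refl
    ; owner = λ {r} {c} g → contradiction g (noGhost r c) }

-- Dark clouds of a staircase shape

-- The invariant once the rows from `n` upwards are processed. By `cover`, each processed cell lies
-- on the hook of a cloud, either in its leg (first case) or in its arm (second case).
record Clouds (D : Diagram) (n : ℕ) (m : Marks) : Set where
  field
    onCell : ∀ {r c} → m c ≡ just r → n ≤ r × D r c ≡ ordinary
    cover  : ∀ {r c} → n ≤ r → D r c ≡ ordinary →
             (∃[ r′ ] r ≤ r′ × m c ≡ just r′) ⊎ (∃[ c′ ] c < c′ × m c′ ≡ just r)
    rising : ∀ {r r′ c c′} → c < c′ → m c ≡ just r → m c′ ≡ just r′ → r < r′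

rightmostFree-nothing : ∀ D m r w → rightmostFree D m r w ≡ nothing →
  ∀ {c} → c < w → D r c ≡ ordinary → ∃[ i ] m c ≡ just i
rightmostFree-nothing D m r (suc w) eq {c} c<1+w Drc with m<1+n⇒m<n∨m≡n c<1+w
... | inj₁ c<w with not (isEmpty (D r w)) | unmarked (m w)
...   | true  | false = rightmostFree-nothing D m r w eq c<w Drc
...   | false | _     = rightmostFree-nothing D m r w eq c<w Drc
rightmostFree-nothing D m r (suc w) eq {c} c<1+w Drc | inj₂ refl rewrite Drc with m w
... | just i = i , refl

rightmostFree-just : ∀ D m r w {b} → rightmostFree D m r w ≡ just b →
  occupied D b r ≡ true × m b ≡ nothing ×
  (∀ {c} → c < w → b < c → D r c ≡ ordinary → ∃[ i ] m c ≡ just i)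
rightmostFree-just D m r (suc w) {b} eq with not (isEmpty (D r w)) in occ | m w in mw
... | true  | nothing with refl ← eq =
  occ , mw , λ c<1+w w<c → contradiction c<1+w (≤⇒≯ w<c)
... | true  | just i with rightmostFree-just D m r w eq
...   | occ′ , free , marked = occ′ , free , marked′
  where
  marked′ : ∀ {c} → c < suc w → b < c → D r c ≡ ordinary → ∃[ i ] m c ≡ just i
  marked′ c<1+w b<c Drc with m<1+n⇒m<n∨m≡n c<1+w
  ... | inj₁ c<w  = marked c<w b<c Drc
  ... | inj₂ refl = i , mw
rightmostFree-just D m r (suc w) {b} eq | false | _ with rightmostFree-just D m r w eq
...   | occ′ , free , marked = occ′ , free , marked′
  where
  marked′ : ∀ {c} → c < suc w → b < c → D r c ≡ ordinary → ∃[ i ] m c ≡ just i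
  marked′ c<1+w b<c Drc with m<1+n⇒m<n∨m≡n c<1+w
  ... | inj₁ c<w  = marked c<w b<c Drc
  ... | inj₂ refl = contradiction (trans (sym (cell⇒occupied {D} Drc)) occ) λ ()

mark-same : ∀ m r c → mark m r c c ≡ just r
mark-same m r c rewrite ≡ᵇ-refl c = refl

mark-other : ∀ m r {c c′} → c′ ≢ c → mark m r c c′ ≡ m c′
mark-other m r c′≢c rewrite ≢⇒≡ᵇ c′≢c = refl

module _ {D : Diagram} {H W : ℕ} (S : Staircase D H W) where
  open Staircase S

  clouds-step : ∀ {n m b} → Clouds D (suc n) m → rightmostFree D m n W ≡ just b →
    Clouds D n (mark m n b)
  clouds-step {n} {m} {b} C eq = record { onCell = onCell′ ; cover = cover′ ; rising = rising′ }
    where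
    open Clouds C
    Dnb : D n b ≡ ordinary
    Dnb = occupied⇒cell (proj₁ (rightmostFree-just D m n W eq))
    free : m b ≡ nothing
    free = proj₁ (proj₂ (rightmostFree-just D m n W eq))
    persists : ∀ {c r} → m c ≡ just r → mark m n b c ≡ just r
    persists mc = trans (mark-other m n λ { refl → contradiction (trans (sym mc) free) λ () }) mc

    marks : ∀ {c r} → mark m n b c ≡ just r → (c ≡ b × r ≡ n) ⊎ m c ≡ just r
    marks {c} m′c with c ≟ b
    ... | yes refl = inj₁ (refl , just-injective (trans (sym m′c) (mark-same m n b)))
    ... | no c≢b   = inj₂ (trans (sym (mark-other m n c≢b)) m′c)

    onCell′ : ∀ {r c} → mark m n b c ≡ just r → n ≤ r × D r c ≡ ordinary
    onCell′ m′c with marks m′c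
    ... | inj₁ (refl , refl) = ≤-refl , Dnb
    ... | inj₂ mc = <⇒≤ (proj₁ (onCell mc)) , proj₂ (onCell mc)

    cover′ : ∀ {r c} → n ≤ r → D r c ≡ ordinary →
      (∃[ r′ ] r ≤ r′ × mark m n b c ≡ just r′) ⊎ (∃[ c′ ] c < c′ × mark m n b c′ ≡ just r)
    cover′ {r} {c} n≤r Drc with m≤n⇒m<n∨m≡n n≤r
    ... | inj₁ n<r with cover n<r Drc
    ...   | inj₁ (r′ , r≤r′ , mc) = inj₁ (r′ , r≤r′ , persists mc)
    ...   | inj₂ (c′ , c<c′ , mc′) = inj₂ (c′ , c<c′ , persists mc′)
    cover′ {r} {c} n≤r Drc | inj₂ refl with <-cmp c b
    ... | tri< c<b _ _ = inj₂ (b , c<b , mark-same m n b)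
    ... | tri≈ _ refl _ = inj₁ (n , ≤-refl , mark-same m n b)
    -- Cells to the right of the new cloud were passed over because their columns already carry a
    -- cloud.
    ... | tri> _ _ b<c with proj₂ (proj₂ (rightmostFree-just D m n W eq)) (colBound Drc) b<c Drc
    ...   | i , mc = inj₁ (i , <⇒≤ (proj₁ (onCell mc)) , persists mc)

    rising′ : ∀ {r r′ c c′} → c < c′ → mark m n b c ≡ just r → mark m n b c′ ≡ just r′ → r < r′
    rising′ c<c′ m′c m′c′ with marks m′c | marks m′c′
    ... | inj₂ mc | inj₂ mc′ = rising c<c′ mc mc′
    ... | inj₁ (refl , refl) | inj₂ mc′ = proj₁ (onCell mc′)
    ... | inj₁ (refl , _) | inj₁ (refl , _) = contradiction c<c′ (n≮n b)
    ... | inj₂ mc | inj₁ (refl , refl) with onCell mc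
    -- An older cloud `(r, c)` left of `b` forces a cell `(r, b)` by `rightEnds`. Its cover is a
    -- cloud in column `b`, which is unmarked, or a second cloud in row `r`, contrary to `rising`.
    ...   | n<r , Drc with cover n<r (rightEnds n<r Drc Dnb c<c′)
    ...     | inj₁ (_ , _ , mb) = contradiction (trans (sym mb) free) λ ()
    ...     | inj₂ (_ , b<c″ , mc″) = contradiction (rising (<-trans c<c′ b<c″) mc mc″) (n≮n _)

  clouds-skip : ∀ {n m} → Clouds D (suc n) m → rightmostFree D m n W ≡ nothing → Clouds D n m
  clouds-skip {n} {m} C eq = record
    { onCell = λ mc → <⇒≤ (proj₁ (onCell mc)) , proj₂ (onCell mc) ; cover = cover′ ; rising = rising }
    where
    open Clouds C
    cover′ : ∀ {r c} → n ≤ r → D r c ≡ ordinary →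
      (∃[ r′ ] r ≤ r′ × m c ≡ just r′) ⊎ (∃[ c′ ] c < c′ × m c′ ≡ just r)
    cover′ n≤r Drc with m≤n⇒m<n∨m≡n n≤r
    ... | inj₁ n<r = cover n<r Drc
    ... | inj₂ refl with rightmostFree-nothing D m n W eq (colBound Drc) Drc
    ...   | i , mc = inj₁ (i , <⇒≤ (proj₁ (onCell mc)) , mc)

  processRows-clouds : ∀ n {m} → Clouds D n m → Clouds D 0 (processRows D W (downFrom n) m)
  processRows-clouds zero    C = C
  processRows-clouds (suc n) {m} C with rightmostFree D m n W in eq
  ... | nothing = processRows-clouds n (clouds-skip C eq)
  ... | just b  = processRows-clouds n (clouds-step C eq)

  darkClouds-clouds : Clouds D 0 (darkClouds H W D)
  darkClouds-clouds = processRows-clouds H (record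
    { onCell = λ () ; cover = λ H≤r Drc → contradiction (rowBound Drc) (≤⇒≯ H≤r) ; rising = λ _ () })

-- Snowflakes column by column

snow : Diagram → Marks → ℕ → ℕ
snow D m c = maybe′ (cnt (vacant D c)) 0 (m c)

-- The summand of `sf` is a local function without a global name; unification recovers it here, so
-- that it can be compared with `snow`.
sf-summand : ∀ H W D → ∃[ f ] sf H W D ≡ sum (map f (upTo W))
sf-summand H W D = _ , refl

sf≡sum-snow : ∀ H W D → sf H W D ≡ sum (map (snow D (darkClouds H W D)) (upTo W))
sf≡sum-snow H W D = cong sum (map-cong summand≗snow (upTo W))
  where
  summand≗snow : ∀ c → proj₁ (sf-summand H W D) c ≡ snow D (darkClouds H W D) c
  summand≗snow c with darkClouds H W D c
  ... | nothing = refl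
  ... | just r₀ = count-upTo (vacant D c) r₀

cells-below : ∀ {D : Diagram} {r c} → D r c ≡ ordinary →
  cnt (occupied D c) (suc r) ≡ suc (cnt (occupied D c) r)
cells-below {D} {r} {c} Drc rewrite cell⇒occupied {D} {r} {c} Drc = refl

-- Upper bound: injecting ghosts into snowflakes

module Bound {D : Diagram} {H W : ℕ} (S : Staircase D H W) {m : Marks} (C : Clouds D 0 m)
             {T : Diagram} {h : ℕ → ℕ → ℕ} (L : Labelled D T h) where
  open Staircase S
  open Clouds C
  open Labelled L

  cells : ℕ → ℕ → ℕ
  cells c n = cnt (occupied D c) n

  -- A dark cloud (i′, c′) is the corner of the hook formed by the cells left of it and
  -- those below it; (c′, x) says that ⟨r, c⟩ is the x-th possible ghost of this hook.
  record Snowflake (g f : ℕ × ℕ) : Set where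
    constructor snowflake
    open Σ g renaming (proj₁ to r; proj₂ to c)
    open Σ f renaming (proj₁ to c′; proj₂ to x)
    field
      {i i′} : ℕ
      owns   : Owns D h i r c
      cloud  : m c′ ≡ just i′
      hook   : (c ≡ c′ × i ≤ i′) ⊎ (c ≤ c′ × i ≡ i′)
      rank   : x + cells c′ (suc i) ≡ r

  row-≤ : ∀ {i b c} → b ≤ c → D i b ≡ ordinary → D i c ≡ ordinary → h i c ≤ h i b
  row-≤ b≤c Dib Dic with m≤n⇒m<n∨m≡n b≤c
  ... | inj₁ b<c = row b<c Dib Dic
  ... | inj₂ refl = ≤-refl

  column-≤ : ∀ {i j c} → i ≤ j → D i c ≡ ordinary → D j c ≡ ordinary → h i c ≤ h j c
  column-≤ i≤j Dic Djc with m≤n⇒m<n∨m≡n i≤j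
  ... | inj₁ i<j = <⇒≤ (column i<j Dic Djc)
  ... | inj₂ refl = ≤-refl

  hook-cell : ∀ {i i′ r c c′} → Owns D h i r c → m c′ ≡ just i′ →
    (c ≡ c′ × i ≤ i′) ⊎ (c ≤ c′ × i ≡ i′) → c ≤ c′ × D i c′ ≡ ordinary
  hook-cell O mc′ (inj₁ (refl , _)) = ≤-refl , Owns.cell O
  hook-cell O mc′ (inj₂ (c≤c′ , refl)) = c≤c′ , proj₂ (onCell mc′)

  -- Labels fall from the owner `(i, c)` along row `i` to `(i, c′)` and then down column `c′`, and
  -- the owner is already below its ghost.
  below-ghost : ∀ {i j r c c′} → Owns D h i r c → c ≤ c′ → D i c′ ≡ ordinary →
    j ≤ i → D j c′ ≡ ordinary → h j c′ < r
  below-ghost O c≤c′ Dic′ j≤i Djc′ = ≤-<-trans (column-≤ j≤i Djc′ Dic′)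
    (≤-<-trans (row-≤ c≤c′ (Owns.cell O) Dic′) (Owns.passed O))

  pack : ∀ c′ {a n r x} → a ≤ n → r ≤ x →
    (∀ {j} → a ≤ j → j < n → D j c′ ≡ ordinary → r ≤ h j c′ × h j c′ < x) →
    r + cells c′ n ≤ x + cells c′ a
  pack c′ a≤n r≤x range = cnt-embed (occupied D c′) (λ j → h j c′)
    (λ i<j pi pj → column i<j (occupied⇒cell pi) (occupied⇒cell pj)) a≤n r≤x
    (λ a≤j j<n pj → range a≤j j<n (occupied⇒cell pj))

  -- Since `i₁ < i₂ ≤ i′`, the lower owner lies in the leg of the hook. The cells of column `c′` in
  -- rows `i₁ < j ≤ i₂` occupy distinct rows strictly between the two ghosts, so the rank still
  -- increases after these cells are discounted.
  rank-mono : ∀ {i₁ i₂ i′ r₁ r₂ c₁ c₂ c′} → Owns D h i₁ r₁ c₁ → Owns D h i₂ r₂ c₂ →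
    m c′ ≡ just i′ →
    (c₁ ≡ c′ × i₁ ≤ i′) ⊎ (c₁ ≤ c′ × i₁ ≡ i′) → (c₂ ≡ c′ × i₂ ≤ i′) ⊎ (c₂ ≤ c′ × i₂ ≡ i′) →
    i₁ < i₂ → r₁ + cells c′ (suc i₂) < r₂ + cells c′ (suc i₁)
  rank-mono O₁ O₂ mc′ (inj₂ (_ , refl)) (inj₁ (_ , i₂≤i′)) i₁<i₂ = contradiction i₂≤i′ (<⇒≱ i₁<i₂)
  rank-mono O₁ O₂ mc′ (inj₂ (_ , refl)) (inj₂ (_ , refl))  i₁<i₂ = contradiction i₁<i₂ (n≮n _)
  rank-mono {c′ = c′} O₁ O₂ mc′ (inj₁ (refl , _)) hook₂ i₁<i₂ with hook-cell O₂ mc′ hook₂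
  ... | c₂≤c′ , Di₂c′ = pack c′ (s≤s (<⇒≤ i₁<i₂))
    (≤-trans (Owns.above O₁ i₁<i₂ Di₂c′) (<⇒≤ (below-ghost O₂ c₂≤c′ Di₂c′ ≤-refl Di₂c′)))
    (λ i₁<j j≤i₂ Djc′ → Owns.above O₁ i₁<j Djc′ ,
                        below-ghost O₂ c₂≤c′ Di₂c′ (s≤s⁻¹ j≤i₂) Djc′)

  snowflake-injective : ∀ {g₁ g₂ f} → Snowflake g₁ f → Snowflake g₂ f → g₁ ≡ g₂
  snowflake-injective {r₁ , c₁} {r₂ , c₂} {c′ , x}
    (snowflake {i₁} O₁ mc₁ hook₁ rank₁) (snowflake {i₂} O₂ mc₂ hook₂ rank₂)
    with just-injective (trans (sym mc₁) mc₂)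
  ... | refl with <-cmp i₁ i₂
  ... | tri< i₁<i₂ _ _ = contradiction (rank-mono O₁ O₂ mc₁ hook₁ hook₂ i₁<i₂)
    (<-irrefl (subst₂ (λ y z → y + cells c′ (suc i₂) ≡ z + cells c′ (suc i₁)) rank₁ rank₂
                (xy∙z≈xz∙y x _ _)))
  ... | tri> _ _ i₂<i₁ = contradiction (rank-mono O₂ O₁ mc₁ hook₂ hook₁ i₂<i₁)
    (<-irrefl (subst₂ (λ y z → y + cells c′ (suc i₁) ≡ z + cells c′ (suc i₂)) rank₂ rank₁
                (xy∙z≈xz∙y x _ _)))
  ... | tri≈ _ refl _ with trans (sym rank₁) rank₂ | <-cmp c₁ c₂
  ...   | refl | tri≈ _ refl _ = refl
  -- Of two owners in one row with ghosts in the same row, the left one would be at or above that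
  -- row by `left`, yet below it by `passed`.
  ...   | refl | tri< c₁<c₂ _ _ = contradiction (Owns.left O₂ c₁<c₂ (Owns.cell O₁)) (<⇒≱ (Owns.passed O₁))
  ...   | refl | tri> _ _ c₂<c₁ = contradiction (Owns.left O₁ c₂<c₁ (Owns.cell O₂)) (<⇒≱ (Owns.passed O₂))

  snowflakes : List (ℕ × ℕ)
  snowflakes = concatMap (λ c → map (c ,_) (upTo (snow D m c))) (upTo W)

  ∈-snowflakes : ∀ {c i x} → m c ≡ just i → x < cnt (vacant D c) i → (c , x) ∈ snowflakes
  ∈-snowflakes {c} {i} {x} mc x< = ∈-concatMap⁺ (λ c → map (c ,_) (upTo (snow D m c)))
    (lose (∈-upTo⁺ (colBound (proj₂ (onCell mc))))
      (∈-map⁺ (c ,_) (∈-upTo⁺ (subst (λ v → x < maybe′ (cnt (vacant D c)) 0 v) (sym mc) x<))))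

  ghost-snowflake : ∀ {r c} → T r c ≡ ghost → ∃[ f ] f ∈ snowflakes × Snowflake (r , c) f
  ghost-snowflake {r} {c} Trc with owner Trc
  ... | i , O with corner (cover z≤n (Owns.cell O))
    where
    corner : (∃[ i′ ] i ≤ i′ × m c ≡ just i′) ⊎ (∃[ c′ ] c < c′ × m c′ ≡ just i) →
      ∃[ c′ ] ∃[ i′ ] m c′ ≡ just i′ × ((c ≡ c′ × i ≤ i′) ⊎ (c ≤ c′ × i ≡ i′)) × i ≤ i′
    corner (inj₁ (i′ , i≤i′ , mc)) = c , i′ , mc , inj₁ (refl , i≤i′) , i≤i′
    corner (inj₂ (c′ , c<c′ , mc′)) = c′ , i , mc′ , inj₂ (<⇒≤ c<c′ , refl) , ≤-refl
  ... | c′ , i′ , mc′ , hook , i≤i′ with hook-cell O mc′ hook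
  ... | c≤c′ , Dic′ = (c′ , x) , ∈-snowflakes mc′ x<snow , snowflake O mc′ hook rank
    where
    enough : cells c′ (suc i) ≤ r
    enough = subst (cells c′ (suc i) ≤_) (+-identityʳ r)
      (pack c′ z≤n z≤n λ _ j≤i Djc′ → z≤n , below-ghost O c≤c′ Dic′ (s≤s⁻¹ j≤i) Djc′)
    -- The number of rows below the ghost, less the cells of column `c′` in rows up to `i`, all of
    -- which lie below the ghost by `enough`.
    x : ℕ
    x = r ∸ cells c′ (suc i)
    rank : x + cells c′ (suc i) ≡ r
    rank = m∸n+n≡m enough
    open ≤-Reasoning
    -- The ghost is no higher than the original row `i` of its owner, and the positions of column
    -- `c′` below row `i` are vacancies and cells of `D`. Discounting the cells leaves snowflakes.
    x<snow : x < cnt (vacant D c′) i′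
    x<snow = <-≤-trans (+-cancelʳ-≤ (cells c′ i) _ _ (begin
      suc x + cells c′ i                   ≡⟨ +-suc x _ ⟨
      x + suc (cells c′ i)                 ≡⟨ cong (x +_) (cells-below {D} Dic′) ⟨
      x + cells c′ (suc i)                 ≡⟨ rank ⟩
      r                                    ≤⟨ Owns.started O ⟩
      i                                    ≡⟨ cnt-not (vacant D c′) i ⟨
      cnt (vacant D c′) i + cells c′ i     ∎)) (cnt-monoʳ (vacant D c′) i≤i′)

  length-snowflakes : ∀ xs → length (concatMap (λ c → map (c ,_) (upTo (snow D m c))) xs) ≡
    sum (map (snow D m) xs)
  length-snowflakes []       = refl
  length-snowflakes (c ∷ xs) = trans (length-++ (map (c ,_) (upTo (snow D m c)))) (cong₂ _+_
    (trans (length-map (c ,_) (upTo (snow D m c))) (length-upTo (snow D m c))) (length-snowflakes xs))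

  ghosts≤snow : ∀ {k} → NumGhosts T k → k ≤ sum (map (snow D m) (upTo W))
  ghosts≤snow (l , unique , refl , ghosts) = subst (length l ≤_) (length-snowflakes (upTo W))
    (injective-length Snowflake snowflake-injective unique
      λ {g} g∈l → ghost-snowflake (Equivalence.to (ghosts (proj₁ g) (proj₂ g)) g∈l))

-- How moves change the set of ghosts

occupied⇒≢ : ∀ {x} → not (isEmpty x) ≡ true → x ≢ empty
occupied⇒≢ occ refl = contradiction occ λ ()

unoccupied⇒≡ : ∀ {x} → not (isEmpty x) ≡ false → x ≡ empty
unoccupied⇒≡ {empty} _ = refl

move-ghost⁺ : ∀ {T r c r̂ k r′ c′} → MoveData T r c r̂ → T r′ c′ ≡ ghost →
  move T r c r̂ k r′ c′ ≡ ghost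
move-ghost⁺ {T} {k = k} M Tg = trans (move-other T k λ { refl →
  (λ { refl → contradiction (trans (sym Tg) hatEmpty) λ () }) ,
  (λ { refl → contradiction (trans (sym Tg) notGhost) λ () }) }) Tg
  where open MoveData M

move-ghost⁻ : ∀ T {r c r̂ k r′ c′} → move T r c r̂ k r′ c′ ≡ ghost →
  T r′ c′ ≡ ghost ⊎ (k ≡ ghost × (r′ , c′) ≡ (r , c))
move-ghost⁻ T {r} {c} {r̂} {k} {r′} {c′} eq
  with move T r c r̂ k r′ c′ | moveView T r c r̂ k r′ c′
... | _ | target _ _       = contradiction eq λ ()
... | _ | source refl refl = inj₂ (eq , refl)
... | _ | other _          = inj₁ eq

NumGhosts-kohnert : ∀ {T r c r̂ k} → MoveData T r c r̂ → NumGhosts T k →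
  NumGhosts (move T r c r̂ empty) k
NumGhosts-kohnert {T} M (l , unique , len , ghosts) = l , unique , len , λ r′ c′ → mk⇔
  (λ ∈l → move-ghost⁺ M (Equivalence.to (ghosts r′ c′) ∈l))
  (λ g → Equivalence.from (ghosts r′ c′) (case move-ghost⁻ T g of λ
    { (inj₁ Tg) → Tg ; (inj₂ (() , _)) }))

NumGhosts-ghost : ∀ {T r c r̂ k} → MoveData T r c r̂ → NumGhosts T k →
  NumGhosts (move T r c r̂ ghost) (suc k)
NumGhosts-ghost {T} {r} {c} {r̂} M (l , unique , len , ghosts) =
  (r , c) ∷ l , All.tabulate fresh ∷ unique , cong suc len , λ r′ c′ → mk⇔
    (λ { (here refl) → move-source T ghost below
       ; (there ∈l) → move-ghost⁺ M (Equivalence.to (ghosts r′ c′) ∈l) })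
    (λ g → case move-ghost⁻ T g of λ
      { (inj₁ Tg) → there (Equivalence.from (ghosts r′ c′) Tg)
      ; (inj₂ (_ , eq)) → here eq })
  where
  open MoveData M
  fresh : ∀ {g} → g ∈ l → (r , c) ≢ g
  fresh g∈l refl = contradiction (trans (sym (Equivalence.to (ghosts r c) g∈l)) notGhost) λ ()

-- Packing and freezing a single column

-- A move from row `r` adds a cell to the rows strictly below (`tally`), and leaves an ordinary cell
-- in row `r - 1` (`next`), from which `freeze` continues.
record Descent (T : Diagram) (r c : ℕ) : Set where
  field
    {r̂}   : ℕ
    valid : MoveData T r c r̂
    tally : ∀ k → cnt (occupied (move T r c r̂ k) c) r ≡ suc (cnt (occupied T c) r)
    next  : ∀ k {y} → suc y ≡ r → move T r c r̂ k y c ≡ ordinary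

descent : ∀ {T r c} → T r c ≡ ordinary → (∀ {y} → y < r → T y c ≢ ghost) →
  (∀ {b} → c < b → T r b ≡ empty) → cnt (occupied T c) r < r → Descent T r c
descent {T} {r} {c} Trc noGhost right room with cnt-gap (occupied T c) r room
... | r̂ , r̂<r , gap , full = record
  { valid = record
    { rightmost = λ eq → contradiction (trans (sym Trc) eq) λ ()
    ; rightmost' = λ _ → right ; notGhost = Trc ; below = r̂<r
    ; hatEmpty = unoccupied⇒≡ gap
    ; hatMaximal = λ _ r̂<y y<r → occupied⇒≢ (full r̂<y y<r)
    ; noGhostBetw = λ _ _ y<r → noGhost y<r }
  ; tally = λ k → cnt-insert r̂<r gap (cell⇒occupied {move T r c r̂ k} {r̂} {c} (move-target T r c r̂ k))
      λ y≢r̂ y<r → cong (not ∘ isEmpty) (move-other T k λ _ → y≢r̂ , <⇒≢ y<r)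
  ; next = next }
  where
  next : ∀ k {y} → suc y ≡ r → move T r c r̂ k y c ≡ ordinary
  next k {y} refl with m<1+n⇒m<n∨m≡n r̂<r
  ... | inj₂ refl = move-target T r c r̂ k
  ... | inj₁ r̂<y = trans (move-other T k λ _ → ≢-sym (<⇒≢ r̂<y) , <⇒≢ (n<1+n y))
    (isOrdinary (occupied⇒≢ (full r̂<y (n<1+n y))) (noGhost (n<1+n y)))

-- By `tally` and `flat`, the `n` cells of column `c` below row `R` fill exactly the rows below `n`.
record Settled (T : Diagram) (R c n k : ℕ) : Set where
  field
    {T′}      : Diagram
    reach     : KKD T T′
    ghosts    : NumGhosts T′ k
    elsewhere : ∀ {r b} → b ≢ c ⊎ R ≤ r → T′ r b ≡ T r b
    noGhost   : ∀ {r} → r < R → T′ r c ≢ ghost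
    tally     : cnt (occupied T′ c) R ≡ n
    flat      : ∀ {r} → n ≤ r → r < R → T′ r c ≡ empty

settle-empty : ∀ {T r c n k} → T r c ≡ empty → Settled T r c n k → Settled T (suc r) c n k
settle-empty {T} {r} {c} {n} Te S = record
  { reach = reach ; ghosts = ghosts
  ; elsewhere = λ { (inj₁ b≢c) → elsewhere (inj₁ b≢c) ; (inj₂ r<y) → elsewhere (inj₂ (<⇒≤ r<y)) }
  ; noGhost = noGhost′ ; tally = tally′ ; flat = flat′ }
  where
  open Settled S
  T′e : T′ r c ≡ empty
  T′e = trans (elsewhere (inj₂ ≤-refl)) Te
  noGhost′ : ∀ {y} → y < suc r → T′ y c ≢ ghost
  noGhost′ y<1+r g with m<1+n⇒m<n∨m≡n y<1+r
  ... | inj₁ y<r  = noGhost y<r g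
  ... | inj₂ refl = contradiction (trans (sym g) T′e) λ ()
  tally′ : cnt (occupied T′ c) (suc r) ≡ n
  tally′ rewrite T′e = tally
  flat′ : ∀ {y} → n ≤ y → y < suc r → T′ y c ≡ empty
  flat′ n≤y y<1+r with m<1+n⇒m<n∨m≡n y<1+r
  ... | inj₁ y<r  = flat n≤y y<r
  ... | inj₂ refl = T′e

-- Work downwards from the top row. While `n ≤ r`, a cell in row `r` has a hole below it and falls;
-- once `n > r`, the remaining rows are full. Cells leave only rows from `n` upwards, so only these
-- rows must be empty to the right.
settle : ∀ R {T c n k} → cnt (occupied T c) R ≡ n → (∀ {r} → r < R → T r c ≢ ghost) →
  (∀ {r b} → n ≤ r → r < R → c < b → T r b ≡ empty) → NumGhosts T k → Settled T R c n k
settle zero cnt≡n noGhost right ghosts = record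
  { reach = ε ; ghosts = ghosts ; elsewhere = λ _ → refl
  ; noGhost = λ () ; tally = cnt≡n ; flat = λ _ () }
settle (suc r) {T} {c} {n} cnt≡n noGhost right ghosts with T r c in Trc
... | ghost = contradiction Trc (noGhost (n<1+n r))
... | empty = settle-empty Trc (settle r cnt≡n (noGhost ∘ m<n⇒m<1+n)
                (λ n≤y y<r → right n≤y (m<n⇒m<1+n y<r)) ghosts)
... | ordinary with n ≤? r
...   | no n≰r = record
  { reach = ε ; ghosts = ghosts ; elsewhere = λ _ → refl
  ; noGhost = noGhost ; tally = trans (cells-below {T} Trc) cnt≡n
  ; flat = λ n≤y y<1+r → contradiction (≤-trans n≤y (s≤s⁻¹ y<1+r)) n≰r }
...   | yes n≤r = record
  { reach = kohnert valid ◅ reach ; ghosts = Settled.ghosts after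
  ; elsewhere = elsewhere′ ; noGhost = Settled.noGhost after
  ; tally = Settled.tally after ; flat = flat }
  where
  open Descent (descent {T} Trc (noGhost ∘ m<n⇒m<1+n) (right n≤r (n<1+n r))
                 (subst (_≤ r) (sym cnt≡n) n≤r))
  T₁ : Diagram
  T₁ = move T r c r̂ empty
  noGhost₁ : ∀ {y} → y < r → T₁ y c ≢ ghost
  noGhost₁ y<r g with move-ghost⁻ T g
  ... | inj₁ Tg = noGhost (m<n⇒m<1+n y<r) Tg
  after : Settled T₁ (suc r) c n _
  after = settle-empty (move-source T empty (MoveData.below valid)) (settle r (trans (tally empty) cnt≡n)
    noGhost₁
    (λ n≤y y<r c<b → trans (move-other T empty λ b≡c → contradiction (sym b≡c) (<⇒≢ c<b))
                       (right n≤y (m<n⇒m<1+n y<r) c<b))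
    (NumGhosts-kohnert valid ghosts))
  open Settled after using (reach; flat)
  elsewhere′ : ∀ {y b} → b ≢ c ⊎ suc r ≤ y → Settled.T′ after y b ≡ T y b
  elsewhere′ away = trans (Settled.elsewhere after away) (move-other T empty λ b≡c →
    case away of λ
      { (inj₁ b≢c) → contradiction b≡c b≢c
      ; (inj₂ r<y) → ≢-sym (<⇒≢ (<-trans (MoveData.below valid) r<y)) , ≢-sym (<⇒≢ r<y) })

-- Each ghost move leaves its ghost in row `r` and all `n` cells below it, so `n` is constant while
-- the bound `suc r` falls to `r`. After `d` moves the bound is `n` and the cells are packed.
freeze : ∀ d {r T c n k} → n + d ≡ suc r → T r c ≡ ordinary → cnt (occupied T c) (suc r) ≡ n →
  (∀ {y} → y < suc r → T y c ≢ ghost) → (∀ {y b} → n ≤ y → y < suc r → c < b → T y b ≡ empty) →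
  NumGhosts T k →
  ∃[ T′ ] KKD T T′ × NumGhosts T′ (k + d) × (∀ {y b} → b ≢ c → T′ y b ≡ T y b)
freeze zero {T = T} {k = k} _ _ _ _ _ ghosts =
  T , ε , subst (NumGhosts T) (sym (+-identityʳ k)) ghosts , λ _ → refl
freeze (suc d) {r} {T} {c} {n} {k} n+1+d≡1+r Trc cnt≡n noGhost right ghosts
  with suc-injective (trans (sym (+-suc n d)) n+1+d≡1+r) | trans (sym (cells-below {T} Trc)) cnt≡n
-- A cell in row 0 makes `n` positive, whereas `n + d` would be 0.
freeze (suc d) {zero} {n = n} n+1+d≡1+r _ _ _ _ _ | n+d≡0 | 1+cnt≡n =
  contradiction (trans 1+cnt≡n (m+n≡0⇒m≡0 n n+d≡0)) λ ()
freeze (suc d) {suc r} {T} {c} {n} {k} _ Trc cnt≡n noGhost right ghosts | n+d≡1+r | 1+cnt≡n =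
  T′ , ghostMv valid ◅ proj₁ (proj₂ rest) ,
  subst (NumGhosts T′) (sym (+-suc k d)) (proj₁ (proj₂ (proj₂ rest))) ,
  λ b≢c → trans (proj₂ (proj₂ (proj₂ rest)) b≢c)
            (move-other T ghost λ b≡c → contradiction b≡c b≢c)
  where
  n≤1+r : n ≤ suc r
  n≤1+r = subst (n ≤_) n+d≡1+r (m≤m+n n d)
  open Descent (descent {T} Trc (noGhost ∘ m<n⇒m<1+n) (right n≤1+r (n<1+n (suc r)))
                 (subst (_≤ suc r) (sym 1+cnt≡n) n≤1+r))
  T₁ : Diagram
  T₁ = move T (suc r) c r̂ ghost
  noGhost₁ : ∀ {y} → y < suc r → T₁ y c ≢ ghost
  noGhost₁ y<1+r g with move-ghost⁻ T g
  ... | inj₁ Tg = noGhost (m<n⇒m<1+n y<1+r) Tg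
  ... | inj₂ (_ , refl) = n≮n _ y<1+r
  right₁ : ∀ {y b} → n ≤ y → y < suc r → c < b → T₁ y b ≡ empty
  right₁ n≤y y<1+r c<b = trans (move-other T ghost λ b≡c → contradiction (sym b≡c) (<⇒≢ c<b))
    (right n≤y (m<n⇒m<1+n y<1+r) c<b)
  rest : ∃[ T″ ] KKD T₁ T″ × NumGhosts T″ (suc k + d) × (∀ {y b} → b ≢ c → T″ y b ≡ T₁ y b)
  rest = freeze d n+d≡1+r (next ghost refl) (trans (tally ghost) 1+cnt≡n) noGhost₁ right₁
    (NumGhosts-ghost valid ghosts)
  T′ : Diagram
  T′ = proj₁ rest

-- Lower bound: freezing the columns from left to right

-- The column has received no ghosts, but its cells below row `R` may have been packed: only their
-- number is remembered.
record Untouched (D T : Diagram) (R c : ℕ) : Set where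
  field
    noGhost : ∀ {r} → T r c ≢ ghost
    same    : ∀ {r} → R ≤ r → T r c ≡ D r c
    tally   : cnt (occupied T c) R ≡ cnt (occupied D c) R

Flat : Diagram → Diagram → ℕ → ℕ → Set
Flat D T R c = ∀ {r} → cnt (occupied D c) R ≤ r → r < R → T r c ≡ empty

untouched-raise : ∀ {D T R R′ c} → R ≤ R′ → Untouched D T R c → Untouched D T R′ c
untouched-raise {D} {T} {c = c} R≤R′ = go (≤⇒≤′ R≤R′)
  where
  go : ∀ {R R′} → R ≤′ R′ → Untouched D T R c → Untouched D T R′ c
  go ≤′-refl U = U
  go (≤′-step {n} R≤n) U = record
    { noGhost = noGhost ; same = same ∘ <⇒≤ ; tally = tally′ }
    where
    open Untouched (go R≤n U)
    tally′ : cnt (occupied T c) (suc n) ≡ cnt (occupied D c) (suc n)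
    tally′ rewrite same ≤-refl | tally = refl

untouched-resp : ∀ {D T T′ R c} → (∀ {r} → T′ r c ≡ T r c) → Untouched D T R c → Untouched D T′ R c
untouched-resp {R = R} T′≗T U = record
  { noGhost = λ g → noGhost (trans (sym T′≗T) g)
  ; same = λ R≤r → trans T′≗T (same R≤r)
  ; tally = trans (cnt-cong R λ _ → cong (not ∘ isEmpty) T′≗T) tally }
  where open Untouched U

module Lower {D : Diagram} {H W : ℕ} (S : Staircase D H W) where
  open Staircase S

  record Cleared (T : Diagram) (R m k : ℕ) : Set where
    field
      {T′}      : Diagram
      reach     : KKD T T′
      ghosts    : NumGhosts T′ k
      untouched : ∀ {b} → m ≤ b → Untouched D T′ R b
      flat      : ∀ {b} → m < b → Flat D T′ R b
      same      : ∀ {r} → T′ r m ≡ T r m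

  -- Pack from right to left. The columns to the right of the current one are already flat and, by
  -- `narrow`, no taller than its packed height, so they do not obstruct it.
  clear : ∀ d {T R m k} →
    (∀ {b c} → m ≤ b → b ≤ c → cnt (occupied D c) R ≤ cnt (occupied D b) R) →
    (∀ {b} → m ≤ b → Untouched D T R b) → (∀ {b} → d + m < b → Flat D T R b) →
    NumGhosts T k → Cleared T R m k
  clear zero narrow untouched flat ghosts = record
    { reach = ε ; ghosts = ghosts ; untouched = untouched ; flat = flat ; same = refl }
  clear (suc d) {T} {R} {m} {k} narrow untouched flat ghosts = record
    { reach = Settled.reach settled ◅◅ Cleared.reach rest ; ghosts = Cleared.ghosts rest
    ; untouched = Cleared.untouched rest ; flat = Cleared.flat rest
    ; same = trans (Cleared.same rest) (Settled.elsewhere settled (inj₁ (<⇒≢ m<c))) }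
    where
    c : ℕ
    c = suc d + m
    m<c : m < c
    m<c = s≤s (m≤n+m m d)
    open Untouched (untouched (<⇒≤ m<c)) renaming (noGhost to noGhostᵀ)
    settled : Settled T R c (cnt (occupied D c) R) k
    settled = settle R tally (λ _ → noGhostᵀ)
      (λ n≤r r<R c<b → flat c<b (≤-trans (narrow (<⇒≤ m<c) (<⇒≤ c<b)) n≤r) r<R) ghosts
    T₁ : Diagram
    T₁ = Settled.T′ settled
    untouched₁ : ∀ {b} → m ≤ b → Untouched D T₁ R b
    untouched₁ {b} m≤b with b ≟ c
    ... | no b≢c   = untouched-resp (Settled.elsewhere settled (inj₁ b≢c)) (untouched m≤b)
    ... | yes refl = record
      { noGhost = noGhost₁
      ; same = λ R≤r → trans (Settled.elsewhere settled (inj₂ R≤r)) (same R≤r)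
      ; tally = Settled.tally settled }
      where
      noGhost₁ : ∀ {r} → T₁ r c ≢ ghost
      noGhost₁ {r} with r <? R
      ... | yes r<R = Settled.noGhost settled r<R
      ... | no r≮R  = λ g → noGhostᵀ (trans (sym (Settled.elsewhere settled (inj₂ (≮⇒≥ r≮R)))) g)
    flat₁ : ∀ {b} → d + m < b → Flat D T₁ R b
    flat₁ {b} c≤b with m≤n⇒m<n∨m≡n c≤b
    ... | inj₂ refl = Settled.flat settled
    ... | inj₁ c<b  = λ n≤r r<R →
      trans (Settled.elsewhere settled (inj₁ (≢-sym (<⇒≢ c<b)))) (flat c<b n≤r r<R)
    rest : Cleared T₁ R m k
    rest = clear d narrow untouched₁ flat₁ (Settled.ghosts settled)

  -- By `leftEnds`, each cell of column `c` in a row up to `i` has a cell of column `b` in its row.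
  narrow : ∀ {i m} → D i m ≡ ordinary → ∀ {b c} → m ≤ b → b ≤ c →
    cnt (occupied D c) (suc i) ≤ cnt (occupied D b) (suc i)
  narrow {i} Dim m≤b b≤c = cnt-monoˡ (suc i) λ j≤i occ →
    cell⇒occupied {D} (leftEnds (s≤s⁻¹ j≤i) Dim (occupied⇒cell occ) m≤b b≤c)

  flat-outside : ∀ {T R c} → W ≤ c → Untouched D T R c → Flat D T R c
  flat-outside {T} {R} {c} W≤c U _ r<R =
    unoccupied⇒≡ (cnt-≡0 (occupied T c) (trans (Untouched.tally U) (none R)) r<R)
    where
    none : ∀ n → cnt (occupied D c) n ≡ 0
    none zero = refl
    none (suc n) with occupied D c n in occ
    ... | false = none n
    ... | true  = contradiction (colBound (occupied⇒cell occ)) (≤⇒≯ W≤c)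

  snowfall : ∀ {T R i m k} → R ≤ i → D i m ≡ ordinary → (∀ {b} → m ≤ b → Untouched D T R b) →
    NumGhosts T k →
    ∃[ T′ ] KKD T T′ × NumGhosts T′ (k + cnt (vacant D m) i) ×
            (∀ {b} → m < b → Untouched D T′ (suc i) b)
  snowfall {T} {R} {i} {m} R≤i Dim untouched ghosts =
    proj₁ frozen , Cleared.reach cleared ◅◅ proj₁ (proj₂ frozen) , proj₁ (proj₂ (proj₂ frozen)) ,
    λ m<b → untouched-resp (proj₂ (proj₂ (proj₂ frozen)) (≢-sym (<⇒≢ m<b)))
              (Cleared.untouched cleared (<⇒≤ m<b))
    where
    raised : ∀ {b} → m ≤ b → Untouched D T (suc i) b
    raised m≤b = untouched-raise (m≤n⇒m≤1+n R≤i) (untouched m≤b)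
    cleared : Cleared T (suc i) m _
    -- Starting at distance `W` is enough: all columns beyond `W + m` lie outside the diagram and
    -- are flat.
    cleared = clear W (narrow Dim) raised
      (λ W+m<b → flat-outside (≤-trans (m≤m+n W m) (<⇒≤ W+m<b))
                   (raised (≤-trans (m≤n+m m W) (<⇒≤ W+m<b)))) ghosts
    -- Fixes the number of ghost moves: rows 0 to `i` of column `m` consist of its cells and the
    -- snowflakes below the cloud.
    total : cnt (occupied D m) (suc i) + cnt (vacant D m) i ≡ suc i
    total = trans (cong (_+ cnt (vacant D m) i) (cells-below {D} Dim))
      (cong suc (trans (+-comm (cnt (occupied D m) i) _) (cnt-not (vacant D m) i)))
    open Untouched (Cleared.untouched cleared {m} ≤-refl) renaming (noGhost to noGhostᵀ)
    frozen = freeze (cnt (vacant D m) i) total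
      -- The cloud is still in place: earlier packing of column `m` stayed below row `R ≤ i`, and
      -- clearing affects other columns only.
      (trans (Cleared.same cleared) (trans (Untouched.same (untouched ≤-refl) R≤i) Dim)) tally
      (λ _ → noGhostᵀ)
      (λ n≤y y≤i m<b → Cleared.flat cleared m<b (≤-trans (narrow Dim ≤-refl (<⇒≤ m<b)) n≤y) y≤i)
      (Cleared.ghosts cleared)

  module _ {m : Marks} (C : Clouds D 0 m) where
    open Clouds C

    sum-snow : ∀ n → sum (map (snow D m) (upTo n)) + snow D m n ≡ sum (map (snow D m) (upTo (suc n)))
    sum-snow n = begin
      sum (map (snow D m) (upTo n)) + snow D m n
        ≡⟨ cong (sum (map (snow D m) (upTo n)) +_) (+-identityʳ (snow D m n)) ⟨
      sum (map (snow D m) (upTo n)) + sum (map (snow D m) (n ∷ []))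
        ≡⟨ sum-++ (map (snow D m) (upTo n)) _ ⟨
      sum (map (snow D m) (upTo n) ++ map (snow D m) (n ∷ []))
        ≡⟨ cong sum (map-++ (snow D m) (upTo n) (n ∷ [])) ⟨
      sum (map (snow D m) (upTo n ∷ʳ n))
        ≡⟨ cong (sum ∘ map (snow D m)) (upTo-∷ʳ n) ⟩
      sum (map (snow D m) (upTo (suc n))) ∎
      where open ≡-Reasoning

    -- The state before column `n` is processed. By `ahead`, packing has not yet reached the row of
    -- any remaining cloud.
    record Snowed (n : ℕ) : Set where
      field
        {T}       : Diagram
        {R}       : ℕ
        reach     : KKD D T
        ghosts    : NumGhosts T (sum (map (snow D m) (upTo n)))
        untouched : ∀ {b} → n ≤ b → Untouched D T R b
        ahead     : ∀ {b i} → n ≤ b → m b ≡ just i → R ≤ i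

    snowed : ∀ n → Snowed n
    snowed zero = record
      { T = D ; R = 0 ; reach = ε
      ; ghosts = [] , [] , refl , λ r c → mk⇔ (λ ()) (λ g → contradiction g (noGhost r c))
      ; untouched = λ _ → record { noGhost = noGhost _ _ ; same = λ _ → refl ; tally = refl }
      ; ahead = λ _ _ → z≤n }
    snowed (suc n) with m n in mn | sum-snow n
    ... | nothing | total = record
      { reach = reach ; ghosts = subst (NumGhosts _) (trans (sym (+-identityʳ _)) total) ghosts
      ; untouched = untouched ∘ <⇒≤ ; ahead = ahead ∘ <⇒≤ }
      where open Snowed (snowed n)
    ... | just i | total = record
      { reach = reach ◅◅ proj₁ (proj₂ fallen)
      ; ghosts = subst (NumGhosts _) total (proj₁ (proj₂ (proj₂ fallen)))
      -- The new bound is `suc i`; later clouds lie in higher rows by `rising`.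
      ; untouched = proj₂ (proj₂ (proj₂ fallen)) ; ahead = λ n<b → rising n<b mn }
      where
      open Snowed (snowed n)
      fallen = snowfall (ahead ≤-refl mn) (proj₂ (onCell mn)) untouched ghosts

-- The maximum for staircase shapes

MaxG≡sf : ∀ {D H W} → Staircase D H W → IsMaxG D (sf H W D)
MaxG≡sf {D} {H} {W} S = subst (IsMaxG D) (sym (sf≡sum-snow H W D)) (
  (T , reach , ghosts) ,
  λ T′ k D↝T′ numGhosts → Bound.ghosts≤snow S C (proj₂ (Upper.labelled S D↝T′ (Upper.initially S))) numGhosts)
  where
  C : Clouds D 0 (darkClouds H W D)
  C = darkClouds-clouds S
  open Lower.Snowed (Lower.snowed S C W)

-- Skew diagrams are staircase shapes

-- The bounds `acc + zs` and `acc + prev + zs` are the ends of the last nonempty row, moved right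
-- once for each empty row since.
skewRows-≥ : ∀ prev acc zs α i {s a} → lookupRow (skewRowsAux prev acc zs α) i ≡ (s , suc a) →
  acc + zs ≤ s × acc + prev + zs ≤ s + suc a
skewRows-≥ prev acc zs (zero ∷ α) (suc i) eq with skewRows-≥ prev acc (suc zs) α i eq
... | start , end = ≤-trans (+-monoʳ-≤ acc (n≤1+n zs)) start ,
                    ≤-trans (+-monoʳ-≤ (acc + prev) (n≤1+n zs)) end
skewRows-≥ prev acc zs (suc a ∷ α) i {s} {a′} eq with acc + (prev ∸ suc a) in acc′
... | acc₁ = go i eq
  where
  acc≤ : acc ≤ acc₁
  acc≤ = subst (acc ≤_) acc′ (m≤m+n acc _)
  -- The shift `prev ∸ suc a` is just enough for a shorter row to end no earlier than its
  -- predecessor.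
  end≤ : acc + prev + zs ≤ acc₁ + suc a + zs
  end≤ = +-monoˡ-≤ zs (begin
    acc + prev                      ≤⟨ +-monoʳ-≤ acc (subst (prev ≤_) (+-comm (suc a) _) (m≤n+m∸n prev (suc a))) ⟩
    acc + (prev ∸ suc a + suc a)    ≡⟨ +-assoc acc _ (suc a) ⟨
    acc + (prev ∸ suc a) + suc a    ≡⟨ cong (_+ suc a) acc′ ⟩
    acc₁ + suc a                    ∎)
    where open ≤-Reasoning
  go : ∀ i → lookupRow ((acc₁ + zs , suc a) ∷ skewRowsAux (suc a) acc₁ zs α) i ≡ (s , suc a′) →
    acc + zs ≤ s × acc + prev + zs ≤ s + suc a′
  go zero refl = +-monoˡ-≤ zs acc≤ , ≤-trans end≤ (≤-reflexive (xy∙z≈xz∙y acc₁ (suc a) zs))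
  go (suc i) eq with skewRows-≥ (suc a) acc₁ zs α i eq
  ... | start , end = ≤-trans (+-monoˡ-≤ zs acc≤) start , ≤-trans end≤ end

-- Once row `j` has been read, its own two ends are the bounds that `skewRows-≥` gives for the
-- remaining rows.
skewRows-mono : ∀ prev acc zs α {j i s s′ a a′} → j < i →
  lookupRow (skewRowsAux prev acc zs α) j ≡ (s , suc a) →
  lookupRow (skewRowsAux prev acc zs α) i ≡ (s′ , suc a′) →
  s ≤ s′ × s + suc a ≤ s′ + suc a′
skewRows-mono prev acc zs (zero ∷ α) {suc j} {suc i} j<i eqⱼ eqᵢ =
  skewRows-mono prev acc (suc zs) α (s<s⁻¹ j<i) eqⱼ eqᵢ
skewRows-mono prev acc zs (suc b ∷ α) {suc j} {suc i} j<i eqⱼ eqᵢ =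
  skewRows-mono (suc b) (acc + (prev ∸ suc b)) zs α (s<s⁻¹ j<i) eqⱼ eqᵢ
skewRows-mono prev acc zs (suc b ∷ α) {zero} {suc i} {s′ = s′} {a′ = a′} j<i refl eqᵢ
  with skewRows-≥ (suc b) (acc + (prev ∸ suc b)) zs α i eqᵢ
... | start , end = start ,
  subst (_≤ s′ + suc a′) (xy∙z≈xz∙y (acc + (prev ∸ suc b)) (suc b) zs) end

skewCell⁺ : ∀ {s l c} → s ≤ c → c < s + l → skewCell (s , l) c ≡ ordinary
skewCell⁺ s≤c c<s+l
  rewrite Equivalence.to T-≡ (≤⇒≤ᵇ s≤c) | Equivalence.to T-≡ (<⇒<ᵇ c<s+l) = refl

skewCell⁻ : ∀ s l {c} → skewCell (s , l) c ≡ ordinary → s ≤ c × c < s + l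
skewCell⁻ s l {c} eq with s ≤ᵇ c in s≤c | c <ᵇ s + l in c<s+l
... | true | true = ≤ᵇ⇒≤ s c (Equivalence.from T-≡ s≤c) , <ᵇ⇒< c (s + l) (Equivalence.from T-≡ c<s+l)

skewCell-≢ghost : ∀ s l c → skewCell (s , l) c ≢ ghost
skewCell-≢ghost s l c with inRange s l c
... | true  = λ ()
... | false = λ ()

record RowOf (α : List ℕ) (r c : ℕ) : Set where
  field
    {start extent} : ℕ
    row   : lookupRow (skewRows α) r ≡ (start , suc extent)
    left  : start ≤ c
    right : c < start + suc extent

skew⁻ : ∀ α {r c} → skew α r c ≡ ordinary → RowOf α r c
skew⁻ α {r} {c} eq with lookupRow (skewRows α) r in row
... | s , zero  = contradiction (proj₁ (skewCell⁻ s 0 eq))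
                    (<⇒≱ (subst (c <_) (+-identityʳ s) (proj₂ (skewCell⁻ s 0 eq))))
... | s , suc l = record { row = row ; left = proj₁ (skewCell⁻ s (suc l) eq)
                         ; right = proj₂ (skewCell⁻ s (suc l) eq) }

skew⁺ : ∀ α {r c s l} → lookupRow (skewRows α) r ≡ (s , l) → s ≤ c → c < s + l → skew α r c ≡ ordinary
skew⁺ α row s≤c c<s+l rewrite row = skewCell⁺ s≤c c<s+l

skewRows-height : ∀ prev acc zs α {r s a} →
  lookupRow (skewRowsAux prev acc zs α) r ≡ (s , suc a) → r < length α
skewRows-height prev acc zs (zero ∷ α)  {suc r} eq = s<s (skewRows-height prev acc (suc zs) α eq)
skewRows-height prev acc zs (suc b ∷ α) {zero}  eq = z<s
skewRows-height prev acc zs (suc b ∷ α) {suc r} eq = s<s (skewRows-height (suc b) _ zs α eq)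

rowEnd-≤-width : ∀ rows {r s l} → lookupRow rows r ≡ (s , suc l) →
  s + suc l ≤ foldr (λ { (s , len) w → (s + len) ⊔ w }) 0 rows
rowEnd-≤-width (_ ∷ rows) {zero}  refl = m≤m⊔n _ _
rowEnd-≤-width (_ ∷ rows) {suc r} eq   = ≤-trans (rowEnd-≤-width rows eq) (m≤n⊔m _ _)

skew-staircase : ∀ α → Staircase (skew α) (skewHeight α) (skewWidth α)
skew-staircase α = record
  { noGhost   = λ r c → skewCell-≢ghost (proj₁ (lookupRow (skewRows α) r)) _ c
  ; rowBound  = λ Drc → skewRows-height 0 0 0 α (RowOf.row (skew⁻ α Drc))
  ; colBound  = λ Drc → <-≤-trans (RowOf.right (skew⁻ α Drc))
                          (rowEnd-≤-width (skewRows α) (RowOf.row (skew⁻ α Drc)))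
  ; rightEnds = λ j<i Dim Djc m<c → rightEnds′ j<i (skew⁻ α Dim) (skew⁻ α Djc) m<c
  ; leftEnds  = λ j≤i Dim Djc m≤b b≤c → leftEnds′ j≤i (skew⁻ α Dim) (skew⁻ α Djc) m≤b b≤c }
  where
  rightEnds′ : ∀ {j i m c} → j < i → RowOf α i m → RowOf α j c → m < c → skew α i c ≡ ordinary
  rightEnds′ j<i I J m<c = skew⁺ α (RowOf.row I)
    (≤-trans (RowOf.left I) (<⇒≤ m<c))
    (<-≤-trans (RowOf.right J) (proj₂ (skewRows-mono 0 0 0 α j<i (RowOf.row J) (RowOf.row I))))

  leftEnds′ : ∀ {j i m b c} → j ≤ i → RowOf α i m → RowOf α j c → m ≤ b → b ≤ c →
    skew α j b ≡ ordinary
  leftEnds′ j≤i I J m≤b b≤c = skew⁺ α (RowOf.row J)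
    (≤-trans start≤ (≤-trans (RowOf.left I) m≤b))
    (≤-<-trans b≤c (RowOf.right J))
    where
    start≤ : RowOf.start J ≤ RowOf.start I
    start≤ with m≤n⇒m<n∨m≡n j≤i
    ... | inj₁ j<i  = proj₁ (skewRows-mono 0 0 0 α j<i (RowOf.row J) (RowOf.row I))
    ... | inj₂ refl = ≤-reflexive (cong proj₁ (trans (sym (RowOf.row J)) (RowOf.row I)))

theorem3p4 : (α : List ℕ) →
    IsMaxG (skew α) (sf (skewHeight α) (skewWidth α) (skew α))
theorem3p4 α = MaxG≡sf (skew-staircase α)
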